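{- Let $G$ be a finite group. Then $rc(\Gamma_G^e)=2$ if and only if $G$ has an awning and $G$ is not a cyclic group.
   Context: Let $G$ be a finite group with identity $e$. The enhanced power graph $\Gamma_G^e$ has vertex set $G$, two distinct vertices $x,y$ being adjacent iff $x,y\in\langle z\rangle$ for some $z\in G$. For a connected graph $\Gamma$, an edge-colouring $\zeta:E(\Gamma)\to\{1,\dots,k\}$ (not necessarily proper) is a rainbow $k$-colouring if every pair of distinct vertices is joined by a path whose edges have pairwise distinct colours; $rc(\Gamma)$ is the minimum such $k$. An essential cyclic set $Max_G=\{x_1,\dots,x_m\}$ is a set of elements of $G$ such that $\langle x_1\rangle,\dots,\langle x_m\rangle$ are pairwise distinct and are exactly the maximal cyclic subgroups of $G$. Awning: given an ordering $x_1,\dots,x_m$ of $Max_G$, an awning is a family of indexed sets $H_1,\dots,H_{m-1}$, where $H_i=\{h_{i,i+1},\dots,h_{i,m}\}\subseteq\langle x_i\rangle$ is partitioned as $H_i=A_i\,\dot\cup\,B_i$, such that (1) $h_{i,j}\in\langle x_i\rangle\cap\langle x_j\rangle$ for all $i<j$; (2) whenever $i<j$, $2\le j\le m-1$, $s\in\{j+1,\dots,m\}$, $r\in\{i+1,\dots,m\}$ and $h_{j,s}=h_{i,r}$: (a) if $r=j$ and $h_{i,r}\in A_i$ then $h_{j,s}\in B_j$; (b) if $r=j$ and $h_{i,r}\in B_i$ then $h_{j,s}\in A_j$; (c) if $r=s>j$ and $h_{i,r}\in A_i$ then $h_{j,r}\in A_j$; (d) if $r=s>j$ and $h_{i,r}\in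 B_i$ then $h_{j,r}\in B_j$. $G$ has an awning if an awning exists for some ordering of $Max_G$. -}

module Defs where

open import Data.Nat using (ℕ; zero; suc)
open import Data.Fin using (Fin; _<_)
open import Data.Bool using (Bool; true; false)
open import Data.List using (List; []; _∷_)
open import Data.List.Relation.Unary.Unique.Propositional using (Unique)
open import Data.Product using (Σ; ∃; ∃-syntax; _×_; _,_)
open import Relation.Binary.PropositionalEquality using (_≡_; _≢_)
open import Relation.Nullary using (¬_)
open import Algebra.Structures using (IsGroup)

-- A finite group: carrier Fin n with a group structure w.r.t. _≡_.
-- (Every finite group is isomorphic to one of this form.)

record FinGroup : Set where
  field
    n       : ℕ
    _∙_     : Fin n → Fin n → Fin n
    ε       : Fin n
    _⁻¹     : Fin n → Fin n
    isGroup : IsGroup _≡_ _∙_ ε _⁻¹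

module _ (G : FinGroup) where
  open FinGroup G

  Elt : Set
  Elt = Fin n

  pow : Elt → ℕ → Elt
  pow z zero    = ε
  pow z (suc k) = z ∙ pow z k

  -- x ∈ ⟨z⟩  (in a finite group ⟨z⟩ = {z^k | k ∈ ℕ})
  _∈⟨_⟩ : Elt → Elt → Set
  x ∈⟨ z ⟩ = ∃[ k ] (pow z k ≡ x)

  _⊆⟨⟩_ : Elt → Elt → Set
  z ⊆⟨⟩ w = ∀ x → x ∈⟨ z ⟩ → x ∈⟨ w ⟩

  _≐⟨⟩_ : Elt → Elt → Set
  z ≐⟨⟩ w = (z ⊆⟨⟩ w) × (w ⊆⟨⟩ z)

  IsCyclicGroup : Set
  IsCyclicGroup = ∃[ g ] (∀ x → x ∈⟨ g ⟩)

  MaximalCyclic : Elt → Set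
  MaximalCyclic x = ∀ z → x ⊆⟨⟩ z → z ⊆⟨⟩ x

  IsEssentialCyclicSet : {m : ℕ} → (Fin m → Elt) → Set
  IsEssentialCyclicSet {m} x =
      (∀ i j → i ≢ j → ¬ (x i ≐⟨⟩ x j))
    × (∀ i → MaximalCyclic (x i))
    × (∀ z → MaximalCyclic z → ∃[ i ] (z ≐⟨⟩ x i))

  -- Awning for the ordering x_0,…,x_{m-1} (0-based indices).
  -- h i j = h_{i,j} (only meaningful for i < j);
  -- inA i g ≡ true means g ∈ A_i, inA i g ≡ false means g ∈ B_i
  -- (this partitions H_i = {h i j | i < j} into A_i ⊔ B_i).
  IsAwning : {m : ℕ} → (Fin m → Elt) → (Fin m → Fin m → Elt) → (Fin m → Elt → Bool) → Set
  IsAwning {m} x h inA =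
      (∀ i j → i < j → (h i j ∈⟨ x i ⟩) × (h i j ∈⟨ x j ⟩))
    × (∀ i j s r → i < j → j < s → i < r → h j s ≡ h i r →
           (r ≡ j → inA i (h i r) ≡ true  → inA j (h j s) ≡ false)
         × (r ≡ j → inA i (h i r) ≡ false → inA j (h j s) ≡ true)
         × (r ≡ s → inA i (h i r) ≡ true  → inA j (h j r) ≡ true)
         × (r ≡ s → inA i (h i r) ≡ false → inA j (h j r) ≡ false))

  HasAwning : Set
  HasAwning = ∃[ m ] Σ (Fin m → Elt) λ x →
    IsEssentialCyclicSet x × ∃[ h ] ∃[ inA ] IsAwning x h inA

  Adj : Elt → Elt → Set
  Adj x y = x ≢ y × ∃[ z ] ((x ∈⟨ z ⟩) × (y ∈⟨ z ⟩))

module _ {V : Set} (E : V → V → Set) where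

  data Walk : V → V → Set where
    []  : ∀ {x} → Walk x x
    _∷_ : ∀ {x y z} → E x y → Walk y z → Walk x z

  vertices : ∀ {x y} → Walk x y → List V
  vertices {x} []       = x ∷ []
  vertices {x} (_ ∷ w)  = x ∷ vertices w

  -- edge-colouring with colours Fin k (i.e. {1,…,k}); the colour of an
  -- edge does not depend on orientation or on the adjacency witness
  record Colouring (k : ℕ) : Set where
    field
      col      : ∀ x y → E x y → Fin k
      col-edge : ∀ x y (p : E x y) (q : E y x) → col x y p ≡ col y x q

  colours : ∀ {k} → Colouring k → ∀ {x y} → Walk x y → List (Fin k)
  colours c []                  = []
  colours c (_∷_ {x} {y} p w)   = Colouring.col c x y p ∷ colours c w

  IsRainbowColouring : ∀ {k} → Colouring k → Set
  IsRainbowColouring c = ∀ x y → x ≢ y →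
    Σ (Walk x y) λ w → Unique (vertices w) × Unique (colours c w)

  HasRainbowColouring : ℕ → Set
  HasRainbowColouring k = Σ (Colouring k) IsRainbowColouring

  RC≡ : ℕ → Set
  RC≡ k = HasRainbowColouring k × (∀ j → j Data.Nat.< k → ¬ HasRainbowColouring j)

EnhancedPowerGraph : (G : FinGroup) → Elt G → Elt G → Set
EnhancedPowerGraph G = Adj G

{-# OPTIONS --safe #-}
-- Write S(u) for the set of indices i with u ∈ ⟨x_i⟩.  An awning amounts to two-colourings
-- c(·, g) of the sets S(g) such that any i ≠ j are separated by some g ∈ ⟨x_i⟩ ∩ ⟨x_j⟩, that is,
-- c(i, g) ≠ c(j, g): put c(i, g) = "g ∈ A_i" and c(j, h_ij) = not c(i, h_ij); the awning
-- conditions say that these prescriptions never clash.  A rainbow 2-colouring ζ yields such c by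
-- c(i, g) = ζ(x_i, g), because distinct x_i, x_j are not adjacent, so their rainbow path has
-- length two.
-- Conversely let m(u) = min S(u).  Flipping c(·, g) if necessary, assume c(m(g), g) = 0.  Colour
-- the edge uw by c(m(u), w) if m(u) ∈ S(w), and by c(m(w), u) if m(w) ∈ S(u).  If both apply then
-- m(u) = m(w) and both values are 0, so this is consistent.  Non-adjacent u, v have disjoint
-- S(u), S(v), and an element separating m(u) from m(v) is the midpoint of a rainbow path.
module Submission where

open import Defs
open import Algebra.Bundles using (Group)
import Algebra.Properties.Group
import Algebra.Properties.Monoid.Mult
open import Data.Bool using (Bool; true; false; not; _xor_)
open import Data.Bool.Properties using (¬-not; not-¬; not-injective; xor-same)
open import Data.Fin using (Fin; zero; suc; toℕ; fromℕ<; _<_; _≤_)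
open import Data.Fin.Induction using (spo-noetherian)
open import Data.Fin.Properties
  using (_≟_; _<?_; <-cmp; ≤-antisym; any?; all?; pigeonhole; injective⇒≤; 2↔Bool;
         toℕ<n; toℕ-fromℕ<)
open import Data.List using (List; []; _∷_; length; lookup; allFin; filter; deduplicate)
open import Data.List.Membership.Propositional.Properties
  using (∈-allFin; ∈-filter⁺; ∈-filter⁻; ∈-lookup; ∈-deduplicate⁻)
import Data.List.Membership.Setoid.Properties as SetoidMembership
open import Data.List.Relation.Unary.All as All using ([]; _∷_)
open import Data.List.Relation.Unary.AllPairs using (AllPairs; []; _∷_)
open import Data.List.Relation.Unary.Any as Any using (index)
open import Data.List.Relation.Unary.Any.Properties using (lookup-index)
import Data.List.Relation.Unary.Unique.DecSetoid.Properties as UniqueDecSetoid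
open import Data.List.Relation.Unary.Unique.Propositional using (Unique)
open import Data.Nat as ℕ using (ℕ; suc; z≤n; s≤s; NonZero)
import Data.Nat.Properties as ℕ
open import Data.Nat.DivMod using (_%_; _/_; m≡m%n+[m/n]*n; m%n<n)
open import Data.Product using (∃; ∃-syntax; _×_; _,_; proj₁; proj₂)
open import Function using (_∘_)
open import Function.Bundles using (_⇔_; mk⇔; Injection)
open import Function.Properties.Inverse using (Inverse⇒Injection; ↔-sym)
open import Induction.WellFounded using (Acc; acc)
open import Relation.Binary using (Symmetric; IsStrictPartialOrder; DecSetoid; tri<; tri≈; tri>)
open import Relation.Binary.PropositionalEquality
open import Relation.Nullary using (¬_; Dec; yes; no; contradiction; _×-dec_; ¬?)
open import Relation.Nullary.Decidable using (map′; _→-dec_)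
open import Relation.Unary using (Decidable)

private
  variable
    A : Set
    n k : ℕ

-- Least witnesses and duplicate-free lists over finite types.

least : {P : Fin n → Set} → Decidable P → ∃ P → ∃[ i ] P i × (∀ j → P j → i ≤ j)
least {n = suc n} P? (i , Pi) with P? zero
... | yes P0 = zero , P0 , λ _ _ → z≤n
... | no ¬P0 with i
...   | zero  = contradiction Pi ¬P0
...   | suc i = let j , Pj , j-least = least (P? ∘ suc) (i , Pi) in
  suc j , Pj , λ { zero P0 → contradiction P0 ¬P0 ; (suc l) Pl → s≤s (j-least l Pl) }

lookup-AllPairs : {R : A → A → Set} → Symmetric R → {xs : List A} → AllPairs R xs →
                  ∀ i j → i ≢ j → R (lookup xs i) (lookup xs j)
lookup-AllPairs s (_ ∷ _)  zero    zero    i≢j = contradiction refl i≢j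
lookup-AllPairs s (r ∷ _)  zero    (suc j) _   = All.lookup r (∈-lookup j)
lookup-AllPairs s (r ∷ _)  (suc i) zero    _   = s (All.lookup r (∈-lookup i))
lookup-AllPairs s (_ ∷ rs) (suc i) (suc j) i≢j = lookup-AllPairs s rs i j (i≢j ∘ cong suc)

-- Bounds the number of edges of a rainbow path by the number of colours.
unique-length : {xs : List (Fin k)} → Unique xs → length xs ℕ.≤ k
unique-length {xs = xs} u = injective⇒≤ {f = lookup xs} inj
  where
  inj : ∀ {i j} → lookup xs i ≡ lookup xs j → i ≡ j
  inj {i} {j} eq with i ≟ j
  ... | yes i≡j = i≡j
  ... | no i≢j  = contradiction eq (lookup-AllPairs ≢-sym u i j i≢j)

-- Decidability of cyclic subgroups and existence of maximal ones.

module CyclicSubgroups (G : FinGroup) where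
  open FinGroup G renaming (n to ∣G∣) using (_∙_; ε; isGroup)

  group : Group _ _
  group = record { isGroup = isGroup }

  open Group group using (monoid; identityʳ)
  open Algebra.Properties.Group group using (identityʳ-unique)
  open Algebra.Properties.Monoid.Mult monoid renaming (_×_ to infixr 30 _·_)

  private
    E : Set
    E = Elt G

    _∈⟪_⟫ _⊑_ _≐_ : E → E → Set
    _∈⟪_⟫ = _∈⟨_⟩ G
    _⊑_   = _⊆⟨⟩_ G
    _≐_   = _≐⟨⟩_ G

  pow≡· : ∀ z k → pow G z k ≡ k · z
  pow≡· z ℕ.zero  = refl
  pow≡· z (suc k) = cong (z ∙_) (pow≡· z k)

  ∈⟨⟩-refl : ∀ {z} → z ∈⟪ z ⟫
  ∈⟨⟩-refl = 1 , identityʳ _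

  ∈⟨⟩-trans : ∀ {x y z} → x ∈⟪ y ⟫ → y ∈⟪ z ⟫ → x ∈⟪ z ⟫
  ∈⟨⟩-trans {z = z} (a , refl) (b , refl) = a ℕ.* b , (begin
    pow G z (a ℕ.* b)      ≡⟨ pow≡· z (a ℕ.* b) ⟩
    (a ℕ.* b) · z          ≡⟨ ×-assocˡ z a b ⟨
    a · (b · z)            ≡⟨ cong (a ·_) (pow≡· z b) ⟨
    a · pow G z b          ≡⟨ pow≡· (pow G z b) a ⟨
    pow G (pow G z b) a    ∎)
    where open ≡-Reasoning

  ∈⇒⊆ : ∀ {z w} → z ∈⟪ w ⟫ → z ⊑ w
  ∈⇒⊆ z∈w x x∈z = ∈⟨⟩-trans x∈z z∈w

  ⊆⇒∈ : ∀ {z w} → z ⊑ w → z ∈⟪ w ⟫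
  ⊆⇒∈ z⊆w = z⊆w _ ∈⟨⟩-refl

  -- Two of the `∣G∣ + 1` powers with exponents `0` to `∣G∣` coincide, and the difference of the two
  -- exponents kills `z`. The bound `d ≤ ∣G∣` lets remainders modulo `d` be indexed by `Fin ∣G∣`.
  exponent : ∀ z → ∃[ d ] NonZero d × d ℕ.≤ ∣G∣ × d · z ≡ ε
  exponent z with i , j , i<j , eq ← pigeonhole (ℕ.n<1+n ∣G∣) (λ i → toℕ i · z) =
    toℕ j ℕ.∸ toℕ i , ℕ.>-nonZero (ℕ.m<n⇒0<n∸m i<j) ,
    ℕ.≤-trans (ℕ.m∸n≤m (toℕ j) (toℕ i)) (ℕ.s≤s⁻¹ (toℕ<n j)) ,
    identityʳ-unique (toℕ i · z) _ (begin
      toℕ i · z ∙ (toℕ j ℕ.∸ toℕ i) · z   ≡⟨ ×-homo-+ z (toℕ i) _ ⟨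
      (toℕ i ℕ.+ (toℕ j ℕ.∸ toℕ i)) · z   ≡⟨ cong (_· z) (ℕ.m+[n∸m]≡n (ℕ.<⇒≤ i<j)) ⟩
      toℕ j · z                           ≡⟨ eq ⟨
      toℕ i · z                           ∎)
    where open ≡-Reasoning

  -- Reducing the exponent modulo `d` does not change the power, so membership in a cyclic subgroup
  -- can be decided by a finite search.
  ∈⟨⟩-bounded : ∀ {x z} → x ∈⟪ z ⟫ → ∃ λ (i : Fin ∣G∣) → pow G z (toℕ i) ≡ x
  ∈⟨⟩-bounded {z = z} (k , refl) with d , d≢0 , d≤∣G∣ , dz≡ε ← exponent z =
    fromℕ< r<∣G∣ , (begin
      pow G z (toℕ (fromℕ< r<∣G∣))        ≡⟨ cong (pow G z) (toℕ-fromℕ< r<∣G∣) ⟩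
      pow G z (k % d)                     ≡⟨ pow≡· z (k % d) ⟩
      (k % d) · z                         ≡⟨ identityʳ _ ⟨
      (k % d) · z ∙ ε                     ≡⟨ cong ((k % d) · z ∙_) (·ε (k / d)) ⟨
      (k % d) · z ∙ (k / d) · ε           ≡⟨ cong (λ e → (k % d) · z ∙ (k / d) · e) dz≡ε ⟨
      (k % d) · z ∙ (k / d) · (d · z)     ≡⟨ cong ((k % d) · z ∙_) (×-assocˡ z (k / d) d) ⟩
      (k % d) · z ∙ (k / d ℕ.* d) · z     ≡⟨ ×-homo-+ z (k % d) (k / d ℕ.* d) ⟨
      (k % d ℕ.+ k / d ℕ.* d) · z         ≡⟨ cong (_· z) (m≡m%n+[m/n]*n k d) ⟨
      k · z                               ≡⟨ pow≡· z k ⟨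
      pow G z k                           ∎)
    where
    instance _ = d≢0
    open ≡-Reasoning
    r<∣G∣ : k % d ℕ.< ∣G∣
    r<∣G∣ = ℕ.<-≤-trans (m%n<n k d) d≤∣G∣
    ·ε : ∀ q → q · ε ≡ ε
    ·ε ℕ.zero  = refl
    ·ε (suc q) = trans (cong (ε ∙_) (·ε q)) (identityʳ ε)

  _∈⟨_⟩? : ∀ x z → Dec (x ∈⟪ z ⟫)
  x ∈⟨ z ⟩? = map′ (λ (i , eq) → toℕ i , eq) ∈⟨⟩-bounded (any? λ i → pow G z (toℕ i) ≟ x)

  -- Inclusion of cyclic subgroups reduces to membership of a generator, which turns maximality into
  -- a finite check.
  maximal⁺ : ∀ {x} → (∀ z → x ∈⟪ z ⟫ → z ∈⟪ x ⟫) → MaximalCyclic G x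
  maximal⁺ f z x⊆z = ∈⇒⊆ (f z (⊆⇒∈ x⊆z))

  maximal⁻ : ∀ {x} → MaximalCyclic G x → ∀ {z} → x ∈⟪ z ⟫ → z ∈⟪ x ⟫
  maximal⁻ f x∈z = ⊆⇒∈ (f _ (∈⇒⊆ x∈z))

  maximal? : Decidable (MaximalCyclic G)
  maximal? x = map′ maximal⁺ (λ M z → maximal⁻ M) (all? λ z → x ∈⟨ z ⟩? →-dec z ∈⟨ x ⟩?)

  _⊏_ : E → E → Set
  z ⊏ w = z ∈⟪ w ⟫ × ¬ w ∈⟪ z ⟫

  ⊏-isStrictPartialOrder : IsStrictPartialOrder _≡_ _⊏_
  ⊏-isStrictPartialOrder = record
    { isEquivalence = isEquivalence
    ; irrefl        = λ { refl (z∈z , z∉z) → z∉z z∈z }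
    ; trans         = λ (a∈b , _) (b∈c , c∉b) →
                        ∈⟨⟩-trans a∈b b∈c , λ c∈a → c∉b (∈⟨⟩-trans c∈a a∈b)
    ; <-resp-≈      = resp₂ _⊏_
    }

  -- Passing to ever larger cyclic subgroups must stop: a strict order on a finite set has no
  -- infinite ascending chain.
  maximal-above : ∀ u → ∃[ z ] MaximalCyclic G z × u ∈⟪ z ⟫
  maximal-above u = climb u ∈⟨⟩-refl (spo-noetherian ⊏-isStrictPartialOrder u)
    where
    climb : ∀ z → u ∈⟪ z ⟫ → Acc (λ a b → b ⊏ a) z → ∃[ z ] MaximalCyclic G z × u ∈⟪ z ⟫
    climb z u∈z (acc rec) with any? (λ w → z ∈⟨ w ⟩? ×-dec ¬? (w ∈⟨ z ⟩?))
    ... | yes (w , z∈w , w∉z) = climb w (∈⟨⟩-trans u∈z z∈w) (rec (z∈w , w∉z))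
    ... | no none = z , maximal⁺ maximal , u∈z
      where
      maximal : ∀ w → z ∈⟪ w ⟫ → w ∈⟪ z ⟫
      maximal w z∈w with w ∈⟨ z ⟩?
      ... | yes w∈z = w∈z
      ... | no w∉z  = contradiction (w , z∈w , w∉z) none

  ≐-decSetoid : DecSetoid _ _
  ≐-decSetoid = record
    { Carrier = E
    ; _≈_     = _≐_
    ; isDecEquivalence = record
      { isEquivalence = record
        { refl  = (λ _ x∈ → x∈) , (λ _ x∈ → x∈)
        ; sym   = λ (p , q) → q , p
        ; trans = λ (p , q) (p′ , q′) → (λ x → p′ x ∘ p x) , (λ x → q x ∘ q′ x)
        }
      ; _≟_ = λ z w → map′ (λ (p , q) → ∈⇒⊆ p , ∈⇒⊆ q) (λ (p , q) → ⊆⇒∈ p , ⊆⇒∈ q)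
                           (z ∈⟨ w ⟩? ×-dec w ∈⟨ z ⟩?)
      }
    }

  -- Deduplicating the list of all generators of maximal cyclic subgroups modulo `≐` leaves one
  -- generator for each.
  essentialCyclicSet : ∃[ m ] ∃[ x ] IsEssentialCyclicSet G {m} x
  essentialCyclicSet =
    length reps , lookup reps ,
    lookup-AllPairs (λ z≉w w≈z → z≉w (≐.sym w≈z)) (UniqueDecSetoid.deduplicate-! ≐-decSetoid maximals) ,
    (λ i → proj₂ (∈-filter⁻ maximal? {xs = allFin ∣G∣}
                   (∈-deduplicate⁻ ≐._≟_ maximals (∈-lookup i)))) ,
    λ z M → let z∈reps = covers z M in index z∈reps , lookup-index z∈reps
    where
    module ≐ = DecSetoid ≐-decSetoid
    maximals reps : List E
    maximals = filter maximal? (allFin ∣G∣)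
    reps     = deduplicate ≐._≟_ maximals
    covers : ∀ z → MaximalCyclic G z → Any.Any (z ≐_) reps
    covers z M = SetoidMembership.∈-deduplicate⁺ ≐.setoid ≐._≟_
      (λ b≈a z≈a → ≐.trans z≈a (≐.sym b≈a))
      (Any.map (λ { refl → ≐.refl }) (∈-filter⁺ maximal? (∈-allFin z) M))

  -- Adjacency in the enhanced power graph, and colourings with fewer than two colours.

  Joined : E → E → Set
  Joined u v = ∃[ z ] u ∈⟪ z ⟫ × v ∈⟪ z ⟫

  joined? : ∀ u v → Dec (Joined u v)
  joined? u v = any? λ z → u ∈⟨ z ⟩? ×-dec v ∈⟨ z ⟩?

  adj? : ∀ u v → Dec (Adj G u v)
  adj? u v = ¬? (u ≟ v) ×-dec joined? u v

  adj-sym : ∀ {u v} → Adj G u v → Adj G v u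
  adj-sym (u≢v , z , u∈z , v∈z) = u≢v ∘ sym , z , v∈z , u∈z

  -- By maximality `⟨z⟩ = ⟨x⟩` whenever `x ∈ ⟨z⟩`, so the closed neighbourhood of `x` is `⟨x⟩`.
  joined-maximal : ∀ {x y} → MaximalCyclic G x → Joined x y → y ∈⟪ x ⟫
  joined-maximal M (_ , x∈z , y∈z) = ∈⟨⟩-trans y∈z (maximal⁻ M x∈z)

  -- With at most one colour, rainbow paths have at most one edge. A generator of a maximal cyclic
  -- subgroup is then adjacent to all other elements, so that subgroup is the whole group.
  rainbow₁⇒cyclic : ∀ {j} → j ℕ.< 2 → HasRainbowColouring (Adj G) j → IsCyclicGroup G
  rainbow₁⇒cyclic j<2 (c , rainbow) with x , M , _ ← maximal-above ε = x , generates
    where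
    generates : ∀ y → y ∈⟪ x ⟫
    generates y with x ≟ y
    ... | yes refl = ∈⟨⟩-refl
    ... | no x≢y with rainbow x y x≢y
    ...   | [] , _ = contradiction refl x≢y
    ...   | (_ , x∼y) ∷ [] , _ = joined-maximal M x∼y
    ...   | _ ∷ _ ∷ _ , _ , unique =
      contradiction (ℕ.≤-trans (unique-length unique) (ℕ.s≤s⁻¹ j<2)) λ { (s≤s ()) }

  cyclic⇒rainbow₁ : IsCyclicGroup G → HasRainbowColouring (Adj G) 1
  cyclic⇒rainbow₁ (g , generates) =
    record { col = λ _ _ _ → zero ; col-edge = λ _ _ _ _ → refl } ,
    λ x y x≢y → ((x≢y , g , generates x , generates y) ∷ []) ,
                ((x≢y ∷ []) ∷ [] ∷ []) , ([] ∷ [])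

  -- c i g only matters for g ∈ ⟨ x i ⟩.
  Separates : {m : ℕ} → (Fin m → E) → (Fin m → E → Bool) → Set
  Separates x c = ∀ i j → i ≢ j → ∃[ g ] g ∈⟪ x i ⟫ × g ∈⟪ x j ⟫ × c i g ≢ c j g

-- From an awning to separating two-colourings.

module FromAwning (G : FinGroup) {m : ℕ} {x : Fin m → Elt G}
                  {h : Fin m → Fin m → Elt G} {inA : Fin m → Elt G → Bool}
                  (awning : IsAwning G x h inA) where
  open CyclicSubgroups G

  private
    hits-later? : ∀ i g → Dec (∃[ s ] i < s × h i s ≡ g)
    hits-later? i g = any? λ s → i <? s ×-dec h i s ≟ g

    hits-earlier? : ∀ i g → Dec (∃[ r ] r < i × h r i ≡ g)
    hits-earlier? i g = any? λ r → r <? i ×-dec h r i ≟ g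

  c : Fin m → Elt G → Bool
  c i g with hits-later? i g
  ... | yes _ = inA i g
  ... | no _ with hits-earlier? i g
  ...   | yes (r , _) = not (inA r g)
  -- Here `g` is none of the elements `h i s` or `h r i`, and separation is tested only at those.
  ...   | no _        = false

  c-lower : ∀ {i j} → i < j → c i (h i j) ≡ inA i (h i j)
  c-lower {i} {j} i<j with hits-later? i (h i j)
  ... | yes _ = refl
  ... | no ∄s = contradiction (j , i<j , refl) ∄s

  private
    alternates : ∀ {i j s} → i < j → j < s → h j s ≡ h i j →
                 inA j (h j s) ≡ not (inA i (h i j))
    alternates {i} {j} {s} i<j j<s eq
      with a , b , _ ← proj₂ awning i j s j i<j j<s i<j eq
      with inA i (h i j)
    ... | true  = a refl refl
    ... | false = b refl refl

    agrees : ∀ {i j s} → i < j → j < s → h j s ≡ h i s →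
             inA j (h j s) ≡ inA i (h i s)
    agrees {i} {j} {s} i<j j<s eq
      with _ , _ , a , b ← proj₂ awning i j s s i<j j<s (ℕ.<-trans i<j j<s) eq
      with inA i (h i s)
    ... | true  = a refl refl
    ... | false = b refl refl

  -- Whichever clause defines `c j (h i j)`, the awning conditions make its value the opposite of
  -- the side chosen in row `i`.
  c-upper : ∀ {i j} → i < j → c j (h i j) ≡ not (inA i (h i j))
  c-upper {i} {j} i<j with hits-later? j (h i j)
  -- The element recurs in row `j` itself: conditions (a) and (b) apply.
  ... | yes (s , j<s , eq) = trans (cong (inA j) (sym eq)) (alternates i<j j<s eq)
  ... | no _ with hits-earlier? j (h i j)
  ...   | no ∄r = contradiction (i , i<j , refl) ∄r
  -- The search may return a row `r` other than `i` with `h r j ≡ h i j`; by (c) and (d) both rows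
  -- put the element on the same side.
  ...   | yes (r , r<j , eq) with <-cmp r i
  ...     | tri≈ _ refl _ = refl
  ...     | tri< r<i _ _ = cong not (trans (cong (inA r) (sym eq)) (sym (agrees r<i i<j (sym eq))))
  ...     | tri> _ _ i<r = cong not (trans (cong (inA r) (sym eq)) (agrees i<r r<j eq))

  private
    separates-< : ∀ {i j} → i < j → c i (h i j) ≢ c j (h i j)
    separates-< i<j eq =
      not-¬ refl (trans (sym (c-lower i<j)) (trans eq (c-upper i<j)))

  separates : Separates x c
  separates i j i≢j with <-cmp i j
  ... | tri< i<j _ _ = let p , q = proj₁ awning i j i<j in
    h i j , p , q , separates-< i<j
  ... | tri≈ _ i≡j _ = contradiction i≡j i≢j
  ... | tri> _ _ j<i = let p , q = proj₁ awning j i j<i in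
    h j i , q , p , separates-< j<i ∘ sym

-- From separating two-colourings to a rainbow 2-colouring.

module ToRainbow (G : FinGroup) {m : ℕ} {x : Fin m → Elt G} (essential : IsEssentialCyclicSet G x)
                 {c₀ : Fin m → Elt G → Bool} (separates₀ : CyclicSubgroups.Separates G x c₀) where
  open CyclicSubgroups G

  private
    E : Set
    E = Elt G

    _∈⟪_⟫ : E → E → Set
    _∈⟪_⟫ = _∈⟨_⟩ G

  covered : ∀ u → ∃[ i ] u ∈⟪ x i ⟫
  covered u with z , M , u∈z ← maximal-above u with i , z⊆ , _ ← proj₂ (proj₂ essential) z M =
    i , z⊆ u u∈z

  private abstract
    first-data : ∀ u → ∃[ i ] u ∈⟪ x i ⟫ × (∀ j → u ∈⟪ x j ⟫ → i ≤ j)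
    first-data u = least (λ i → u ∈⟨ x i ⟩?) (covered u)

  first : E → Fin m
  first u = proj₁ (first-data u)

  ∈-first : ∀ u → u ∈⟪ x (first u) ⟫
  ∈-first u = proj₁ (proj₂ (first-data u))

  first-least : ∀ u {j} → u ∈⟪ x j ⟫ → first u ≤ j
  first-least u = proj₂ (proj₂ (first-data u)) _

  c : Fin m → E → Bool
  c i g = c₀ (first g) g xor c₀ i g

  c-first : ∀ g → c (first g) g ≡ false
  c-first g = xor-same (c₀ (first g) g)

  private
    xor-cancelˡ : ∀ b {a a′} → b xor a ≡ b xor a′ → a ≡ a′
    xor-cancelˡ true  = not-injective
    xor-cancelˡ false = λ eq → eq

  -- The correction bit depends on `g` alone, so it flips both compared values or neither.
  separates : Separates x c
  separates i j i≢j with g , p , q , sep ← separates₀ i j i≢j =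
    g , p , q , sep ∘ xor-cancelˡ (c₀ (first g) g)

  -- Minimality of `first` in both directions forces `first u ≡ first w`, and then both sides are
  -- normalised values.
  c-symmetric : ∀ {u w} → w ∈⟪ x (first u) ⟫ → u ∈⟪ x (first w) ⟫ →
                c (first u) w ≡ c (first w) u
  c-symmetric {u} {w} w∈ u∈
    with firsts-equal ← ≤-antisym (first-least u u∈) (first-least w w∈) = begin
      c (first u) w  ≡⟨ cong (λ i → c i w) firsts-equal ⟩
      c (first w) w  ≡⟨ c-first w ⟩
      false          ≡⟨ c-first u ⟨
      c (first u) u  ≡⟨ cong (λ i → c i u) firsts-equal ⟩
      c (first w) u  ∎
    where open ≡-Reasoning

  ζ : E → E → Bool
  ζ u w with w ∈⟨ x (first u) ⟩? | u ∈⟨ x (first w) ⟩?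
  ... | yes _ | _     = c (first u) w
  ... | no _  | yes _ = c (first w) u
  -- An arbitrary colour: the two-edge paths chosen in `rainbow` avoid such edges.
  ... | no _  | no _  = false

  ζ-sym : ∀ u w → ζ u w ≡ ζ w u
  ζ-sym u w with w ∈⟨ x (first u) ⟩? | u ∈⟨ x (first w) ⟩?
  ... | yes p | yes q = c-symmetric p q
  ... | yes _ | no _  = refl
  ... | no _  | yes _ = refl
  ... | no _  | no _  = refl

  ζ-first : ∀ {u w} → w ∈⟪ x (first u) ⟫ → ζ u w ≡ c (first u) w
  ζ-first {u} {w} w∈ with w ∈⟨ x (first u) ⟩? | u ∈⟨ x (first w) ⟩?
  ... | yes _ | _ = refl
  ... | no w∉ | _ = contradiction w∈ w∉

  open Injection (Inverse⇒Injection (↔-sym 2↔Bool))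
    using () renaming (to to fromBool; injective to fromBool-injective)

  colouring : Colouring (Adj G) 2
  colouring = record
    { col      = λ u w _ → fromBool (ζ u w)
    ; col-edge = λ u w _ _ → cong fromBool (ζ-sym u w)
    }

  rainbow : IsRainbowColouring (Adj G) colouring
  rainbow u v u≢v with joined? u v
  ... | yes u∼v = ((u≢v , u∼v) ∷ []) , ((u≢v ∷ []) ∷ [] ∷ []) , ([] ∷ [])
  -- Equal first indices would put `u` and `v` into one cyclic subgroup.
  ... | no u≁v with separates (first u) (first v)
                     (λ eq → u≁v (x (first u) , ∈-first u ,
                                  subst (λ i → v ∈⟪ x i ⟫) (sym eq) (∈-first v)))
  ...   | g , g∈u , g∈v , sep =
    ((u≢g , u∼g) ∷ (g≢v , g∼v) ∷ []) ,
    ((u≢g ∷ u≢v ∷ []) ∷ (g≢v ∷ []) ∷ [] ∷ []) ,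
    ((distinct ∷ []) ∷ [] ∷ [])
    where
    u∼g : Joined u g
    u∼g = x (first u) , ∈-first u , g∈u
    g∼v : Joined g v
    g∼v = x (first v) , g∈v , ∈-first v
    u≢g : u ≢ g
    u≢g refl = u≁v g∼v
    g≢v : g ≢ v
    g≢v refl = u≁v u∼g
    distinct : fromBool (ζ u g) ≢ fromBool (ζ g v)
    distinct eq = sep (begin
      c (first u) g  ≡⟨ ζ-first g∈u ⟨
      ζ u g          ≡⟨ fromBool-injective eq ⟩
      ζ g v          ≡⟨ ζ-sym g v ⟩
      ζ v g          ≡⟨ ζ-first g∈v ⟩
      c (first v) g  ∎)
      where open ≡-Reasoning

-- From a rainbow 2-colouring to an awning.

module FromRainbow (G : FinGroup) (γ : Colouring (Adj G) 2) (rainbow : IsRainbowColouring (Adj G) γ) where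
  open CyclicSubgroups G
  open Colouring γ
  open Injection (Inverse⇒Injection 2↔Bool)
    using () renaming (to to toBool; injective to toBool-injective)

  private
    E : Set
    E = Elt G

    _∈⟪_⟫ : E → E → Set
    _∈⟪_⟫ = _∈⟨_⟩ G

  ζ : E → E → Bool
  ζ u v with adj? u v
  ... | yes p = toBool (col u v p)
  ... | no _  = false

  -- Going to the reversed edge and back by `col-edge` shows that the colour does not depend on the
  -- adjacency witness.
  ζ-col : ∀ {u v} (p : Adj G u v) → ζ u v ≡ toBool (col u v p)
  ζ-col {u} {v} p with adj? u v
  ... | yes q = cong toBool (trans (col-edge u v q (adj-sym p)) (sym (col-edge u v p (adj-sym p))))
  ... | no ¬p = contradiction p ¬p

  -- Non-adjacency excludes a single edge and two colours exclude three edges, so the rainbow path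
  -- has exactly two edges, of opposite colours.
  midpoint : ∀ {u v} → u ≢ v → ¬ Joined u v →
             ∃[ g ] Joined u g × Joined v g × ζ v g ≡ not (ζ u g)
  midpoint {u} {v} u≢v u≁v with rainbow u v u≢v
  ... | [] , _ = contradiction refl u≢v
  ... | (_ , u∼v) ∷ [] , _ = contradiction u∼v u≁v
  ... | _ ∷ _ ∷ _ ∷ _ , _ , unique = contradiction (unique-length unique) λ { (s≤s (s≤s ())) }
  ... | _∷_ {y = g} p (q ∷ []) , _ , ((p≢q ∷ []) ∷ _) =
    g , proj₂ p , proj₂ (adj-sym q) , ¬-not λ eq → p≢q (toBool-injective (begin
      toBool (col u g p)            ≡⟨ ζ-col p ⟨
      ζ u g                         ≡⟨ eq ⟨
      ζ v g                         ≡⟨ ζ-col (adj-sym q) ⟩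
      toBool (col v g (adj-sym q))  ≡⟨ cong toBool (col-edge g v q (adj-sym q)) ⟨
      toBool (col g v q)            ∎))
    where open ≡-Reasoning

  module _ {m : ℕ} {x : Fin m → E} (essential : IsEssentialCyclicSet G x) where

    private
      maximal : ∀ i → MaximalCyclic G (x i)
      maximal = proj₁ (proj₂ essential)

    not-joined : ∀ i j → i ≢ j → ¬ Joined (x i) (x j)
    not-joined i j i≢j (z , i∈z , j∈z) = proj₁ essential i j i≢j
      ( ∈⇒⊆ (joined-maximal (maximal j) (z , j∈z , i∈z))
      , ∈⇒⊆ (joined-maximal (maximal i) (z , i∈z , j∈z)))

    private
      h-data : ∀ i j → ∃[ g ] (i < j → g ∈⟪ x i ⟫ × g ∈⟪ x j ⟫ × ζ (x j) g ≡ not (ζ (x i) g))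
      h-data i j with i ≟ j
      -- A placeholder on the diagonal, where no midpoint exists; the guard `i < j` makes the claim
      -- vacuous.
      ... | yes refl = x i , λ i<i → contradiction i<i (ℕ.<-irrefl refl)
      ... | no i≢j with g , i∼g , j∼g , flips ← midpoint
                          (λ eq → not-joined i j i≢j (x i , ∈⟨⟩-refl , subst (_∈⟪ x i ⟫) eq ∈⟨⟩-refl))
                          (not-joined i j i≢j) =
        g , λ _ → joined-maximal (maximal i) i∼g , joined-maximal (maximal j) j∼g , flips

    h : Fin m → Fin m → E
    h i j = proj₁ (h-data i j)

    inA : Fin m → E → Bool
    inA i = ζ (x i)

    private
      flips : ∀ {i j} → i < j → inA j (h i j) ≡ not (inA i (h i j))
      flips {i} {j} i<j = proj₂ (proj₂ (proj₂ (h-data i j) i<j))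

    isAwning : IsAwning G x h inA
    isAwning = (λ i j i<j → let p , q , _ = proj₂ (h-data i j) i<j in p , q) , coherent
      where
      alternates : ∀ {i j s b} → i < j → h j s ≡ h i j →
                   inA i (h i j) ≡ b → inA j (h j s) ≡ not b
      alternates {j = j} i<j eq b = trans (cong (inA j) eq) (trans (flips i<j) (cong not b))

      -- The common element is a midpoint towards `x s` from both `x i` and `x j`, so both values
      -- are opposite to its value at `s`.
      agrees : ∀ {i j s b} → i < s → j < s → h j s ≡ h i s →
               inA i (h i s) ≡ b → inA j (h j s) ≡ b
      agrees {s = s} i<s j<s eq b =
        trans (not-injective (trans (sym (flips j<s)) (trans (cong (inA s) eq) (flips i<s)))) b

      coherent : ∀ i j s r → i < j → j < s → i < r → h j s ≡ h i r →
           (r ≡ j → inA i (h i r) ≡ true  → inA j (h j s) ≡ false)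
         × (r ≡ j → inA i (h i r) ≡ false → inA j (h j s) ≡ true)
         × (r ≡ s → inA i (h i r) ≡ true  → inA j (h j r) ≡ true)
         × (r ≡ s → inA i (h i r) ≡ false → inA j (h j r) ≡ false)
      coherent i j s r i<j j<s i<r eq =
        (λ { refl → alternates i<j eq }) , (λ { refl → alternates i<j eq }) ,
        (λ { refl → agrees i<r j<s eq }) , (λ { refl → agrees i<r j<s eq })

-- The two implications combined.

theorem2p17 : (G : FinGroup) →
    RC≡ (EnhancedPowerGraph G) 2 ⇔ (HasAwning G × ¬ IsCyclicGroup G)
theorem2p17 G = mk⇔ to from
  where
  open CyclicSubgroups G

  to : RC≡ (EnhancedPowerGraph G) 2 → HasAwning G × ¬ IsCyclicGroup G
  to ((γ , rainbow) , minimal) with m , x , essential ← essentialCyclicSet =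
    (m , x , essential , h essential , inA essential , isAwning essential) ,
    -- A cyclic group has a complete graph, for which one colour suffices, against minimality of
    -- two.
    λ cyclic → minimal 1 (s≤s (s≤s z≤n)) (cyclic⇒rainbow₁ cyclic)
    where open FromRainbow G γ rainbow

  from : HasAwning G × ¬ IsCyclicGroup G → RC≡ (EnhancedPowerGraph G) 2
  from ((m , x , essential , h , inA , awning) , noncyclic) =
    (ToRainbow.colouring G essential separates , ToRainbow.rainbow G essential separates) ,
    λ j j<2 → noncyclic ∘ rainbow₁⇒cyclic j<2
    where open FromAwning G {x = x} {h} {inA} awning
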